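{- Let $G$ be a group with finite generating set $S$, and suppose $G$ has decidable word problem. Then the ouroboros problem for $(G,S)$ is in $\Sigma^0_1$.
   Context: The word problem of $(G,S)$ asks whether a given word over $S\cup S^{ -1}$ evaluates to $1_G$. A tileset graph for $(G,S)$ is a finite multigraph $\Gamma=(A,B)$ with vertex set $A$ whose edges are triples $(a,a',s)$ with $a,a'\in A$ and $s\in S\cup S^{ -1}$, such that $(a,a',s)\in B$ implies $(a',a,s^{ -1})\in B$. A $\Gamma$-ouroboros is a pair $(\omega,\zeta)$ with $\omega:\llbracket 0,n\rrbracket\to G$, $n\ge 2$, injective except that $\omega(0)=\omega(n)$, and $\zeta:\llbracket 0,n\rrbracket\to A$, such that for all $0\le i<n$, $d\omega_i:=\omega(i)^{ -1}\omega(i+1)\in S\cup S^{ -1}$ and $(\zeta(i),\zeta(i+1),d\omega_i)\in B$. The ouroboros problem for $(G,S)$: given $\Gamma$, decide whether a $\Gamma$-ouroboros exists. -}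

module Defs where

open import Level using (Level; _⊔_)
open import Algebra.Bundles using (Group)
open import Data.Nat using (ℕ; zero; suc; _≤_)
open import Data.Fin using (Fin; toℕ; inject₁; fromℕ) renaming (zero to fzero; suc to fsuc)
open import Data.Bool using (Bool; true; false; not)
open import Data.Product using (Σ; ∃; _×_; _,_)
open import Data.Sum using (_⊎_)
open import Data.List using (List; foldr)
open import Data.List.Membership.Propositional using (_∈_)
open import Relation.Binary.PropositionalEquality using (_≡_)
open import Relation.Nullary using (Dec)

-- Letters of S ∪ S⁻¹ for S = {s₀,…,s_{k-1}}: (i , false) stands for sᵢ,
-- (i , true) stands for sᵢ⁻¹.
Letter : ℕ → Set
Letter k = Fin k × Bool

invLetter : ∀ {k} → Letter k → Letter k
invLetter (i , b) = i , not b

record TilesetGraph (k : ℕ) : Set where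
  field
    m     : ℕ
    edges : List (Fin m × Fin m × Letter k)
    sym   : ∀ a a' s → (a , a' , s) ∈ edges → (a' , a , invLetter s) ∈ edges
open TilesetGraph public

module _ {c ℓ : Level} (G : Group c ℓ) {k : ℕ} (gens : Fin k → Group.Carrier G) where
  open Group G

  ⟦_⟧ : Letter k → Carrier
  ⟦ i , false ⟧ = gens i
  ⟦ i , true ⟧  = gens i ⁻¹

  evalWord : List (Letter k) → Carrier
  evalWord = foldr (λ l g → ⟦ l ⟧ ∙ g) ε

  Generates : Set (c ⊔ ℓ)
  Generates = ∀ g → ∃ λ (w : List (Letter k)) → evalWord w ≈ g

  DecidableWordProblem : Set ℓ
  DecidableWordProblem = ∀ (w : List (Letter k)) → Dec (evalWord w ≈ ε)

  -- A Γ-ouroboros of length n: ω, ζ : ⟦0,n⟧ → G, A  (⟦0,n⟧ = Fin (suc n)).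
  record Ouroboros (Γ : TilesetGraph k) (n : ℕ) : Set (c ⊔ ℓ) where
    field
      n≥2      : 2 ≤ n
      ω        : Fin (suc n) → Carrier
      ζ        : Fin (suc n) → Fin (m Γ)
      closed   : ω fzero ≈ ω (fromℕ n)
      injExcept : ∀ i j → ω i ≈ ω j →
                  i ≡ j ⊎ (toℕ i ≡ 0 × toℕ j ≡ n) ⊎ (toℕ i ≡ n × toℕ j ≡ 0)
      steps    : ∀ (i : Fin n) → Σ (Letter k) λ s →
                   (ω (inject₁ i) ⁻¹ ∙ ω (fsuc i) ≈ ⟦ s ⟧)
                   × ((ζ (inject₁ i) , ζ (fsuc i) , s) ∈ edges Γ)

  HasOuroboros : TilesetGraph k → Set (c ⊔ ℓ)
  HasOuroboros Γ = Σ ℕ λ n → Ouroboros Γ n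

-- A family of propositions indexed by tileset graphs is Σ⁰₁ (semi-decidable):
-- there is a (necessarily computable, being an Agda function) procedure
-- f such that P Γ holds iff f Γ n ≡ true for some n.
InSigma01 : ∀ {p} {k : ℕ} → (TilesetGraph k → Set p) → Set p
InSigma01 {k = k} P =
  Σ (TilesetGraph k → ℕ → Bool) λ f →
    ∀ Γ → (P Γ → Σ ℕ λ n → f Γ n ≡ true) × ((Σ ℕ λ n → f Γ n ≡ true) → P Γ)

{-# OPTIONS --safe #-}

-- An ouroboros is determined, up to left translation by ω 0, by the word
-- w of its steps: ω i = ω 0 · w₁ ⋯ wᵢ. All its defining conditions only
-- compare such prefixes, and the word problem decides u ≈ v as
-- u v⁻¹ ≈ 1. So for fixed n, an ouroboros of length n exists iff one of
-- the finitely many pairs (w , ζ) ∈ (S ∪ S⁻¹)ⁿ × Aⁿ⁺¹ passes a decidable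
-- test, and searching over n gives the semi-decision procedure.
module Submission where

open import Defs
open import Algebra.Bundles using (Group)
open import Data.Nat using (ℕ)
open import Data.Fin using (Fin)

open import Level using (Level; suc)
import Algebra.Properties.Group as GroupProperties
open import Data.Bool using (Bool; true; false)
open import Data.Bool.Properties using (T-≡)
import Data.Bool.Properties as Bool
import Data.Fin.Properties as Fin
open import Data.Fin using (toℕ; inject₁; fromℕ) renaming (zero to fzero; suc to fsuc)
open import Data.List using (List; []; _∷_; _++_; [_])
open import Data.List.Membership.Propositional using (_∈_)
import Data.List.Membership.DecPropositional as DecMembership
import Data.Nat as ℕ
open import Data.Product using (Σ; ∃; ∃₂; _×_; _,_; proj₁; proj₂)
import Data.Product.Properties as Product
open import Data.Sum using (_⊎_; inj₁; inj₂)
open import Data.Vec using (Vec; []; _∷_; lookup; tabulate)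
open import Data.Vec.Properties using (lookup∘tabulate)
open import Function.Bundles using (Equivalence)
open import Relation.Binary.Definitions using (DecidableEquality)
open import Relation.Binary.PropositionalEquality using (_≡_; subst)
import Relation.Binary.PropositionalEquality as ≡
open import Relation.Nullary using (Dec)
open import Relation.Nullary.Decidable
  using (_×-dec_; _⊎-dec_; _→-dec_; map′; isYes; toWitness; fromWitness)
open import Relation.Unary using (Pred; Decidable)

Searchable : (p : Level) → Set → Set (suc p)
Searchable p A = {P : Pred A p} → Decidable P → Dec (∃ P)

module _ {p : Level} where

  Fin-searchable : ∀ {n} → Searchable p (Fin n)
  Fin-searchable = Fin.any?

  Bool-searchable : Searchable p Bool
  Bool-searchable P? =
    map′ (λ { (inj₁ p) → false , p ; (inj₂ p) → true , p })
         (λ { (false , p) → inj₁ p ; (true , p) → inj₂ p })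
         (P? false ⊎-dec P? true)

  ×-searchable : ∀ {A B} → Searchable p A → Searchable p B → Searchable p (A × B)
  ×-searchable searchA searchB P? =
    map′ (λ { (a , b , p) → (a , b) , p }) (λ { ((a , b) , p) → a , b , p })
         (searchA λ a → searchB λ b → P? (a , b))

  Vec-searchable : ∀ {A} → Searchable p A → ∀ n → Searchable p (Vec A n)
  Vec-searchable searchA ℕ.zero P? =
    map′ ([] ,_) (λ { ([] , p) → p }) (P? [])
  Vec-searchable searchA (ℕ.suc n) P? =
    map′ (λ { (a , v , p) → a ∷ v , p }) (λ { (a ∷ v , p) → a , v , p })
         (searchA λ a → Vec-searchable searchA n λ v → P? (a ∷ v))

Letter-searchable : ∀ {p k} → Searchable p (Letter k)
Letter-searchable = ×-searchable Fin-searchable Bool-searchable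

Letter-≟ : ∀ {k} → DecidableEquality (Letter k)
Letter-≟ = Product.≡-dec Fin._≟_ Bool._≟_

InSigma01-∃ : ∀ {p k} {P : TilesetGraph k → ℕ → Set p} →
              (∀ Γ n → Dec (P Γ n)) → InSigma01 (λ Γ → Σ ℕ (P Γ))
InSigma01-∃ P? =
  (λ Γ n → isYes (P? Γ n)) , λ Γ →
    (λ { (n , p) → n , Equivalence.to T-≡ (fromWitness p) })
  , (λ { (n , e) → n , toWitness (Equivalence.from T-≡ e) })

prefix : ∀ {A : Set} {n} → Vec A n → Fin (ℕ.suc n) → List A
prefix v       fzero    = []
prefix (a ∷ v) (fsuc i) = a ∷ prefix v i

module Paths {c ℓ : Level} (G : Group c ℓ) {k : ℕ} (gens : Fin k → Group.Carrier G) where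
  open Group G renaming (sym to ≈-sym)
  open GroupProperties G
  open import Relation.Binary.Reasoning.Setoid setoid

  private
    ev : List (Letter k) → Carrier
    ev = evalWord G gens

    ⟪_⟫ : Letter k → Carrier
    ⟪_⟫ = ⟦_⟧ G gens

  invWord : List (Letter k) → List (Letter k)
  invWord []      = []
  invWord (l ∷ u) = invWord u ++ [ invLetter l ]

  evalWord-++ : ∀ u v → ev (u ++ v) ≈ ev u ∙ ev v
  evalWord-++ []      v = ≈-sym (identityˡ (ev v))
  evalWord-++ (l ∷ u) v = trans (∙-congˡ (evalWord-++ u v)) (≈-sym (assoc ⟪ l ⟫ (ev u) (ev v)))

  ⟦invLetter⟧ : ∀ l → ⟪ invLetter l ⟫ ≈ ⟪ l ⟫ ⁻¹
  ⟦invLetter⟧ (i , false) = refl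
  ⟦invLetter⟧ (i , true)  = ≈-sym (⁻¹-involutive (gens i))

  evalWord-invWord : ∀ u → ev (invWord u) ≈ ev u ⁻¹
  evalWord-invWord []      = ≈-sym ε⁻¹≈ε
  evalWord-invWord (l ∷ u) = begin
    ev (invWord u ++ [ invLetter l ])       ≈⟨ evalWord-++ (invWord u) [ invLetter l ] ⟩
    ev (invWord u) ∙ (⟪ invLetter l ⟫ ∙ ε)  ≈⟨ ∙-cong (evalWord-invWord u) (trans (identityʳ _) (⟦invLetter⟧ l)) ⟩
    ev u ⁻¹ ∙ ⟪ l ⟫ ⁻¹                      ≈⟨ ⁻¹-anti-homo-∙ ⟪ l ⟫ (ev u) ⟨
    (⟪ l ⟫ ∙ ev u) ⁻¹                       ∎

  evalWord-≈? : DecidableWordProblem G gens → ∀ u v → Dec (ev u ≈ ev v)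
  evalWord-≈? wp u v =
    map′ (λ e → x∙y⁻¹≈ε⇒x≈y (ev u) (ev v) (trans (≈-sym u·v⁻¹) e))
         (λ e → trans u·v⁻¹ (x≈y⇒x∙y⁻¹≈ε e))
         (wp (u ++ invWord v))
    where
    u·v⁻¹ : ev (u ++ invWord v) ≈ ev u ∙ ev v ⁻¹
    u·v⁻¹ = trans (evalWord-++ u (invWord v)) (∙-congˡ (evalWord-invWord v))

  path : ∀ {n} → Vec (Letter k) n → Fin (ℕ.suc n) → Carrier
  path w i = ev (prefix w i)

  path-suc : ∀ {n} (w : Vec (Letter k) n) (i : Fin n) →
             path w (fsuc i) ≈ path w (inject₁ i) ∙ ⟪ lookup w i ⟫
  path-suc (a ∷ w) fzero    = trans (identityʳ ⟪ a ⟫) (≈-sym (identityˡ ⟪ a ⟫))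
  path-suc (a ∷ w) (fsuc i) =
    trans (∙-congˡ (path-suc w i)) (≈-sym (assoc ⟪ a ⟫ (path w (inject₁ i)) ⟪ lookup w i ⟫))

  path-step : ∀ {n} (w : Vec (Letter k) n) (i : Fin n) →
              path w (inject₁ i) \\ path w (fsuc i) ≈ ⟪ lookup w i ⟫
  path-step w i = trans (∙-congˡ (path-suc w i)) (\\-leftDividesʳ _ _)

  walk≈translated-path : ∀ {n} (ω : Fin (ℕ.suc n) → Carrier) (w : Vec (Letter k) n) →
                         (∀ i → ω (inject₁ i) \\ ω (fsuc i) ≈ ⟪ lookup w i ⟫) →
                         ∀ i → ω i ≈ ω fzero ∙ path w i
  walk≈translated-path ω w       steps fzero    = ≈-sym (identityʳ (ω fzero))
  walk≈translated-path ω (a ∷ w) steps (fsuc i) = begin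
    ω (fsuc i)                           ≈⟨ walk≈translated-path (λ j → ω (fsuc j)) w (λ j → steps (fsuc j)) i ⟩
    ω (fsuc fzero) ∙ path w i            ≈⟨ ∙-congʳ first-step ⟩
    (ω fzero ∙ ⟪ a ⟫) ∙ path w i         ≈⟨ assoc (ω fzero) ⟪ a ⟫ (path w i) ⟩
    ω fzero ∙ path (a ∷ w) (fsuc i)      ∎
    where
    first-step : ω (fsuc fzero) ≈ ω fzero ∙ ⟪ a ⟫
    first-step = trans (≈-sym (\\-leftDividesˡ (ω fzero) (ω (fsuc fzero)))) (∙-congˡ (steps fzero))

module Ouroboroi {c ℓ : Level} (G : Group c ℓ) {k : ℕ} (gens : Fin k → Group.Carrier G) where
  open Group G renaming (sym to ≈-sym)
  open GroupProperties G using (∙-cancelˡ)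
  open Paths G gens

  SameOrEnds : (n : ℕ) → Fin (ℕ.suc n) → Fin (ℕ.suc n) → Set
  SameOrEnds n i j = i ≡ j ⊎ (toℕ i ≡ 0 × toℕ j ≡ n) ⊎ (toℕ i ≡ n × toℕ j ≡ 0)

  sameOrEnds? : ∀ n i j → Dec (SameOrEnds n i j)
  sameOrEnds? n i j =
    i Fin.≟ j ⊎-dec (toℕ i ℕ.≟ 0 ×-dec toℕ j ℕ.≟ n) ⊎-dec (toℕ i ℕ.≟ n ×-dec toℕ j ℕ.≟ 0)

  WordOuroboros : (Γ : TilesetGraph k) (n : ℕ) → Vec (Letter k) n → Vec (Fin (m Γ)) (ℕ.suc n) → Set ℓ
  WordOuroboros Γ n w z =
    2 ℕ.≤ n ×
    path w fzero ≈ path w (fromℕ n) ×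
    (∀ i j → path w i ≈ path w j → SameOrEnds n i j) ×
    (∀ i → (lookup z (inject₁ i) , lookup z (fsuc i) , lookup w i) ∈ edges Γ)

  wordOuroboros? : DecidableWordProblem G gens → ∀ Γ n w z → Dec (WordOuroboros Γ n w z)
  wordOuroboros? wp Γ n w z =
    2 ℕ.≤? n ×-dec
    path≈? fzero (fromℕ n) ×-dec
    Fin.all? (λ i → Fin.all? λ j → path≈? i j →-dec sameOrEnds? n i j) ×-dec
    Fin.all? (λ i → (lookup z (inject₁ i) , lookup z (fsuc i) , lookup w i) ∈? edges Γ)
    where
    open DecMembership (Product.≡-dec Fin._≟_ (Product.≡-dec Fin._≟_ Letter-≟)) using (_∈?_)

    path≈? : ∀ i j → Dec (path w i ≈ path w j)
    path≈? i j = evalWord-≈? wp (prefix w i) (prefix w j)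

  wordOuroboros⇒ouroboros : ∀ {Γ n w z} → WordOuroboros Γ n w z → Ouroboros G gens Γ n
  wordOuroboros⇒ouroboros {w = w} {z} (n≥2 , closed , injective , onEdges) = record
    { n≥2       = n≥2
    ; ω         = path w
    ; ζ         = lookup z
    ; closed    = closed
    ; injExcept = injective
    ; steps     = λ i → lookup w i , path-step w i , onEdges i
    }

  ouroboros⇒wordOuroboros : ∀ {Γ n} → Ouroboros G gens Γ n → ∃₂ (WordOuroboros Γ n)
  ouroboros⇒wordOuroboros {Γ} {n} o = w , z , n≥2 , closed′ , injective′ , onEdges
    where
    open Ouroboros o

    w : Vec (Letter k) n
    w = tabulate (λ i → proj₁ (steps i))

    z : Vec (Fin (m Γ)) (ℕ.suc n)
    z = tabulate ζ

    w-steps : ∀ i → ω (inject₁ i) \\ ω (fsuc i) ≈ ⟦_⟧ G gens (lookup w i)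
    w-steps i = subst (λ l → ω (inject₁ i) \\ ω (fsuc i) ≈ ⟦_⟧ G gens l)
                      (≡.sym (lookup∘tabulate (λ i → proj₁ (steps i)) i))
                      (proj₁ (proj₂ (steps i)))

    translated : ∀ i → ω i ≈ ω fzero ∙ path w i
    translated = walk≈translated-path ω w w-steps

    closed′ : path w fzero ≈ path w (fromℕ n)
    closed′ = ∙-cancelˡ (ω fzero) _ _
      (trans (≈-sym (translated fzero)) (trans closed (translated (fromℕ n))))

    injective′ : ∀ i j → path w i ≈ path w j → SameOrEnds n i j
    injective′ i j e =
      injExcept i j (trans (translated i) (trans (∙-congˡ e) (≈-sym (translated j))))

    onEdges : ∀ i → (lookup z (inject₁ i) , lookup z (fsuc i) , lookup w i) ∈ edges Γ
    onEdges i rewrite lookup∘tabulate ζ (inject₁ i) | lookup∘tabulate ζ (fsuc i)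
                    | lookup∘tabulate (λ i → proj₁ (steps i)) i = proj₂ (proj₂ (steps i))

  ouroboros? : DecidableWordProblem G gens → ∀ Γ n → Dec (Ouroboros G gens Γ n)
  ouroboros? wp Γ n =
    map′ (λ (w , z , wo) → wordOuroboros⇒ouroboros {w = w} {z} wo) ouroboros⇒wordOuroboros
         (Vec-searchable Letter-searchable n λ w →
            Vec-searchable Fin-searchable (ℕ.suc n) λ z → wordOuroboros? wp Γ n w z)

proposition2 : ∀ {c ℓ} (G : Group c ℓ) (k : ℕ) (gens : Fin k → Group.Carrier G) →
                 Generates G gens → DecidableWordProblem G gens →
                 InSigma01 (HasOuroboros G gens)
proposition2 G k gens _ wp = InSigma01-∃ (ouroboros? wp)
  where open Ouroboroi G gens
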